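{- Let $k$ be a positive integer. If $G$ is a $2k$-connected $(P_2\cup kP_1)$-free graph with $\tau(G)>1$, then $G$ is hamiltonian-connected.
   Context: All graphs are finite and simple. For a graph $H$, a graph $G$ is $H$-free if $G$ contains no induced subgraph isomorphic to $H$. $P_n$ is the path on $n$ vertices, $P_1$ is a single vertex, and $P_2\cup kP_1$ is the disjoint union of an edge and $k$ isolated vertices. For a graph $G$, $c(G)$ is the number of components of $G$. The toughness of $G$ is $\tau(G)=\min\{|S|/c(G-S): S\subseteq V(G),\ c(G-S)\ge 2\}$ if $G$ is not complete, and $\tau(G)=\infty$ if $G$ is complete. A graph is hamiltonian-connected if for every two distinct vertices $a,b$ there is a path from $a$ to $b$ containing all vertices of the graph. -}

module Defs where

open import Data.Fin using (Fin; toℕ; _≟_)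
open import Data.Fin.Properties using (all?)
open import Data.Fin.Subset using (Subset; inside; outside; _∈_; ∁; ∣_∣)
open import Data.Fin.Subset.Properties using (_∈?_)
open import Data.Integer using (+_)
open import Data.List using (List; []; _∷_; _++_; map; length; filter; deduplicate; allFin; head; last)
open import Data.List.Membership.Propositional using () renaming (_∈_ to _∈ˡ_)
open import Data.List.Membership.Propositional.Properties using (∈-allFin)
import Data.List.Extrema
open import Data.List.Relation.Unary.Any using (here; there)
open import Data.List.Relation.Unary.Linked using (Linked)
open import Data.List.Relation.Unary.Unique.Propositional using (Unique)
open import Data.Maybe using (just)
open import Data.Nat using (ℕ; zero; suc; _≤_; _<_; _≤?_; NonZero; >-nonZero; z<s)
open import Data.Nat.Properties using (1+n≢n; <-≤-trans)
import Data.Nat as ℕ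
open import Data.Product using (_×_; _,_; ∃-syntax)
open import Data.Rational using (ℚ; _/_)
import Data.Rational as ℚ
import Data.Rational.Properties as ℚ
open import Data.Sum using (_⊎_; inj₁; inj₂; swap)
open import Data.Sum.Relation.Binary.Pointwise using (Pointwise; inj₁; inj₂)
import Data.Sum.Relation.Binary.Pointwise as Pointwise
open import Data.Vec using ([]; _∷_)
open import Function using (_⇔_)
open import Function.Definitions using (Injective)
open import Level using (0ℓ)
open import Relation.Binary using (Rel; Decidable; Symmetric; TotalOrder)
open import Relation.Binary.Construct.Closure.ReflexiveTransitive using (Star; ε; _◅_; _◅◅_)
import Relation.Binary.Construct.Add.Supremum.NonStrict as NonStrict
import Relation.Binary.Construct.Add.Supremum.Strict as Strict
open import Relation.Binary.PropositionalEquality using (_≡_; _≢_; refl; sym)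
open import Relation.Nullary using (Dec; yes; no; ¬_; ¬?; map′; _×-dec_; _⊎-dec_; _→-dec_)
open import Relation.Nullary.Construct.Add.Supremum using (_⁺; [_]; ⊤⁺)

record Graph (V : Set) : Set₁ where
  field
    Adj     : Rel V 0ℓ
    adj?    : Decidable Adj
    adj-sym : Symmetric Adj
    no-loop : ∀ {v} → ¬ Adj v v

open Graph public

P : (n : ℕ) → Graph (Fin n)
P n = record
  { Adj     = λ i j → toℕ j ≡ suc (toℕ i) ⊎ toℕ i ≡ suc (toℕ j)
  ; adj?    = λ i j → (toℕ j ℕ.≟ suc (toℕ i)) ⊎-dec (toℕ i ℕ.≟ suc (toℕ j))
  ; adj-sym = swap
  ; no-loop = λ { (inj₁ e) → 1+n≢n (sym e) ; (inj₂ e) → 1+n≢n (sym e) }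
  }

infixr 6 _∪_
infixr 7 _·_

_∪_ : {V W : Set} → Graph V → Graph W → Graph (V ⊎ W)
G ∪ H = record
  { Adj     = Pointwise (Adj G) (Adj H)
  ; adj?    = Pointwise.⊎-decidable (adj? G) (adj? H)
  ; adj-sym = Pointwise.⊎-symmetric (adj-sym G) (adj-sym H)
  ; no-loop = λ { (inj₁ a) → no-loop G a ; (inj₂ a) → no-loop H a }
  }

-- The disjoint union of k copies of H.
_·_ : {V : Set} (k : ℕ) → Graph V → Graph (Fin k × V)
k · H = record
  { Adj     = λ { (i , u) (j , v) → i ≡ j × Adj H u v }
  ; adj?    = λ { (i , u) (j , v) → (i ≟ j) ×-dec adj? H u v }
  ; adj-sym = λ { (e , a) → sym e , adj-sym H a }
  ; no-loop = λ { (_ , a) → no-loop H a }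
  }

-- An isomorphism from H onto an induced subgraph of G.
record InducedCopy {W V : Set} (H : Graph W) (G : Graph V) : Set where
  field
    embed     : W → V
    injective : Injective _≡_ _≡_ embed
    adj⇔      : ∀ u v → Adj H u v ⇔ Adj G (embed u) (embed v)

infix 4 _IsFree_

_IsFree_ : {V W : Set} → Graph V → Graph W → Set
G IsFree H = ¬ InducedCopy H G

-- Decidability of reachability over Fin n, by the Floyd–Warshall recursion
-- on the vertices allowed as intermediate stops.

module _ {n : ℕ} {R : Rel (Fin n) 0ℓ} where

  private
    Via : List (Fin n) → Rel (Fin n) 0ℓ
    Via []       u v = u ≡ v ⊎ R u v
    Via (w ∷ ws) u v = Via ws u v ⊎ (Via ws u w × Via ws w v)

    via? : Decidable R → ∀ ws → Decidable (Via ws)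
    via? R? []       u v = (u ≟ v) ⊎-dec R? u v
    via? R? (w ∷ ws) u v = via? R? ws u v ⊎-dec (via? R? ws u w ×-dec via? R? ws w v)

    via-refl : ∀ ws {v} → Via ws v v
    via-refl []       = inj₁ refl
    via-refl (_ ∷ ws) = inj₁ (via-refl ws)

    via-step : ∀ ws {u v} → R u v → Via ws u v
    via-step []       r = inj₂ r
    via-step (_ ∷ ws) r = inj₁ (via-step ws r)

    via-join : ∀ ws {u w v} → w ∈ˡ ws → Via ws u w → Via ws w v → Via ws u v
    via-join (_ ∷ ws) (here refl) p q = inj₂ (to p , from q)
      where
      to : ∀ {u w} → Via ws u w ⊎ (Via ws u w × Via ws w w) → Via ws u w
      to (inj₁ p)       = p
      to (inj₂ (p , _)) = p
      from : ∀ {w v} → Via ws w v ⊎ (Via ws w w × Via ws w v) → Via ws w v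
      from (inj₁ q)       = q
      from (inj₂ (_ , q)) = q
    via-join (_ ∷ ws) (there m) (inj₁ p)       (inj₁ q)       = inj₁ (via-join ws m p q)
    via-join (_ ∷ ws) (there m) (inj₁ p)       (inj₂ (q , r)) = inj₂ (via-join ws m p q , r)
    via-join (_ ∷ ws) (there m) (inj₂ (p , q)) (inj₁ r)       = inj₂ (p , via-join ws m q r)
    via-join (_ ∷ ws) (there m) (inj₂ (p , _)) (inj₂ (_ , r)) = inj₂ (p , r)

    via⇒star : ∀ ws {u v} → Via ws u v → Star R u v
    via⇒star []       (inj₁ refl)    = ε
    via⇒star []       (inj₂ r)       = r ◅ ε
    via⇒star (_ ∷ ws) (inj₁ p)       = via⇒star ws p
    via⇒star (_ ∷ ws) (inj₂ (p , q)) = via⇒star ws p ◅◅ via⇒star ws q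

    star⇒via : ∀ {u v} → Star R u v → Via (allFin n) u v
    star⇒via ε        = via-refl (allFin n)
    star⇒via (r ◅ rs) = via-join (allFin n) (∈-allFin _) (via-step (allFin n) r) (star⇒via rs)

  star? : Decidable R → Decidable (Star R)
  star? R? u v = map′ (via⇒star (allFin n)) star⇒via (via? R? (allFin n) u v)

-- For U ⊆ V(G), these definitions concern the induced
-- subgraph G[U]; thus G − S is given by U = ∁ S.

module _ {n : ℕ} (G : Graph (Fin n)) (U : Subset n) where

  AdjIn : Rel (Fin n) 0ℓ
  AdjIn u v = u ∈ U × v ∈ U × Adj G u v

  -- Being in the same component of G[U], for u and v in U.
  Joined : Rel (Fin n) 0ℓ
  Joined = Star AdjIn

  joined? : Decidable Joined
  joined? = star? λ u v → (u ∈? U) ×-dec (v ∈? U) ×-dec adj? G u v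

  -- The number of components of G[U]: deduplication keeps exactly one
  -- vertex of each.
  c : ℕ
  c = length (deduplicate joined? (filter (_∈? U) (allFin n)))

  Connected : Set
  Connected = ∀ {u v} → u ∈ U → v ∈ U → Joined u v

infix 4 _IsConnected_

-- G is k-connected: it has more than k vertices, and deleting fewer than k
-- vertices never disconnects it.
_IsConnected_ : {n : ℕ} → ℕ → Graph (Fin n) → Set
_IsConnected_ {n} k G = k < n × (∀ S → ∣ S ∣ < k → Connected G (∁ S))

Complete : {n : ℕ} → Graph (Fin n) → Set
Complete G = ∀ u v → u ≢ v → Adj G u v

complete? : {n : ℕ} (G : Graph (Fin n)) → Dec (Complete G)
complete? G = all? λ u → all? λ v → ¬? (u ≟ v) →-dec adj? G u v

ℚ∞ : Set
ℚ∞ = ℚ ⁺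

∞ : ℚ∞
∞ = ⊤⁺

open Strict ℚ._<_ public using () renaming (_<⁺_ to _<∞_)

ℚ∞-totalOrder : TotalOrder 0ℓ 0ℓ 0ℓ
ℚ∞-totalOrder = record
  { isTotalOrder = NonStrict.≤⁺-isTotalOrder-≡ ℚ._≤_ ℚ.≤-isTotalOrder }

open Data.List.Extrema ℚ∞-totalOrder using (min)

subsets : ∀ n → List (Subset n)
subsets zero    = [] ∷ []
subsets (suc n) = map (inside ∷_) (subsets n) ++ map (outside ∷_) (subsets n)

-- |S| / c(G − S), or ∞ if S is not admissible, i.e. c(G − S) < 2.
ratio : {n : ℕ} → Graph (Fin n) → Subset n → ℚ∞
ratio G S with 2 ≤? c G (∁ S)
... | yes 2≤c = [ _/_ (+ ∣ S ∣) (c G (∁ S)) {{>-nonZero (<-≤-trans z<s 2≤c)}} ]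
... | no  _   = ∞

-- In the non-complete case an admissible S exists (all vertices but two
-- non-adjacent ones), so neither the initial value ∞ nor the ∞ contributed
-- by inadmissible sets affects the minimum.
τ : {n : ℕ} → Graph (Fin n) → ℚ∞
τ {n} G with complete? G
... | yes _ = ∞
... | no  _ = min ∞ (map (ratio G) (subsets n))

-- A path from a to b, given as its list of vertices.
record IsPath {V : Set} (G : Graph V) (a b : V) (p : List V) : Set where
  field
    starts   : head p ≡ just a
    ends     : last p ≡ just b
    linked   : Linked (Adj G) p
    distinct : Unique p

HamiltonianConnected : {V : Set} → Graph V → Set
HamiltonianConnected G =
  ∀ a b → a ≢ b → ∃[ p ] (IsPath G a b p × (∀ v → v ∈ˡ p))

module Submission where

-- Let p be a longest a–b path, w a vertex off p, and H the component of w in G − p.  By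
-- 2k-connectedness H has at least 2k neighbours on p, and the successors of these on p
-- form with w an independent set I of size at least 2k.  Call a vertex dominated if it has
-- a neighbour in I.  As G is (P₂ ∪ kP₁)-free, the undominated vertices are independent and
-- a dominated vertex misses fewer than k vertices of I, so that any two dominated vertices
-- have two common neighbours in I.  Rerouting p through H therefore shows that p contains
-- every dominated vertex and never passes two of them in a row.  Hence the dominated
-- vertices number at most one more than the undominated vertices on p, that is (w being off
-- p) at most as many as all undominated ones, which are the components left when the
-- dominated vertices are deleted: this contradicts τ(G) > 1.

open import Defs
open import Data.Nat using (ℕ; _*_; NonZero)
open import Data.Fin using (Fin)
open import Data.Rational using (1ℚ)
open import Relation.Nullary.Construct.Add.Supremum using ([_])
open import Data.Bool using (if_then_else_)
open import Data.Empty using (⊥)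
open import Data.Fin using (zero; suc; _≟_; inject≤)
open import Data.Fin.Properties using (any?; injective⇒≤; inject≤-injective; suc-injective)
open import Data.Fin.Subset using (Subset; inside; outside; ∁; ∣_∣) renaming (_∈_ to _∈ˢ_; ⊥ to ∅)
open import Data.Fin.Subset.Properties using (_∈?_; x∈∁p⇒x∉p; x∉p⇒x∈∁p; ∣⊥∣≡0; ∉⊥)
open import Data.Integer using (+_)
import Data.Integer as ℤ
import Data.Integer.Properties as ℤ
open import Data.List
  using (List; []; _∷_; _++_; map; length; filter; deduplicate; allFin; lookup; reverse; head; last)
import Data.List.Extrema
open import Data.List.Membership.Propositional using (_∈_; _∉_; find; lose)
open import Data.List.Membership.Propositional.Properties
  using (∈-allFin; ∈-filter⁺; ∈-filter⁻; ∈-length; ∈-lookup; ∈-map⁺; ∈-map⁻; ∈-++⁺ˡ; ∈-++⁺ʳ)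
open import Data.List.Properties
  using (filter-all; length-map; length-++; length-tabulate; unfold-reverse; ∷-injectiveʳ; ++-assoc)
open import Data.List.Relation.Binary.Permutation.Propositional
  using (_↭_; ↭-sym; ↭-trans; prep; ↭⇒↭ₛ)
open import Data.List.Relation.Binary.Permutation.Propositional.Properties
  using (↭-length; shifts; ++⁺; ++⁺ˡ; ++⁺ʳ; ↭-reverse)
open import Data.List.Relation.Binary.Permutation.Setoid.Properties using (Unique-resp-↭)
open import Data.List.Relation.Binary.Subset.Propositional using (_⊆_)
open import Data.List.Relation.Unary.All as All using (All; []; _∷_)
open import Data.List.Relation.Unary.AllPairs using ([]; _∷_; allPairs?)
open import Data.List.Relation.Unary.Any as Any using (Any; here; there)
open import Data.List.Relation.Unary.Any.Properties using (lookup-index)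
open import Data.List.Relation.Unary.Linked using (Linked; [-]; _∷_)
open import Data.List.Relation.Unary.Unique.Propositional using (Unique)
import Data.List.Relation.Unary.Unique.Propositional.Properties as Unique
open import Data.Maybe using (just)
open import Data.Maybe.Properties using (just-injective)
open import Data.Nat
  using (zero; suc; pred; _+_; _≤_; _<_; _≤?_; >-nonZero; >-nonZero⁻¹; z≤n; s≤s; s≤s⁻¹; z<s)
open import Data.Nat.Properties hiding (suc-injective; _≟_)
open import Data.Product using (_×_; _,_; ∃; ∃₂; proj₁; proj₂)
import Data.Rational as ℚ
import Data.Rational.Properties as ℚ
import Data.Rational.Unnormalised as ℚᵘ
import Data.Rational.Unnormalised.Properties as ℚᵘ
open import Data.Sum as Sum using (_⊎_; inj₁; inj₂)
open import Data.Sum.Relation.Binary.Pointwise using (inj₁; inj₂)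
open import Data.Vec as Vec using ([]; _∷_; tabulate)
open import Data.Vec.Properties using (lookup∘tabulate; lookup⇒[]=; []=⇒lookup)
open import Function using (_∘_; id; case_of_; mk⇔; _⇔_)
open import Function.Definitions using (Injective)
open import Level using (0ℓ)
open import Relation.Binary using (Rel; Decidable; Symmetric)
open import Relation.Binary.Construct.Add.Supremum.NonStrict ℚ._≤_ using (_≤⁺_; [_]; _≤⊤⁺)
open import Relation.Binary.Construct.Add.Supremum.Strict using ([_]; [_]<⊤⁺)
open import Relation.Binary.Construct.Closure.ReflexiveTransitive as Star using (Star; ε; _◅_; _◅◅_)
open import Relation.Binary.PropositionalEquality
  using (_≡_; _≢_; refl; sym; trans; cong; subst; setoid)
open import Relation.Nullary using (Dec; yes; no; ¬_; ¬?; does; map′; _×-dec_)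
open import Relation.Nullary.Decidable using (dec-true; decidable-stable)
open import Relation.Nullary.Negation using (contradiction)
open import Relation.Unary using (Pred)
import Relation.Unary as U

private
  variable
    A : Set
    k n : ℕ

-- Lists and finite sets

lookup-injective : {xs : List A} → Unique xs → Injective _≡_ _≡_ (lookup xs)
lookup-injective {xs = _ ∷ _} (_ ∷ _)   {zero}  {zero}  _  = refl
lookup-injective {xs = _ ∷ _} (x∉ ∷ _)  {zero}  {suc j} eq = contradiction eq (All.lookup x∉ (∈-lookup j))
lookup-injective {xs = _ ∷ _} (x∉ ∷ _)  {suc i} {zero}  eq = contradiction (sym eq) (All.lookup x∉ (∈-lookup i))
lookup-injective {xs = _ ∷ _} (_ ∷ xs!) {suc i} {suc j} eq = cong suc (lookup-injective xs! eq)

-- Pigeonhole: equal positions in `ys` carry equal entries, so `position` is injective.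
unique-⊆⇒length≤ : {xs ys : List A} → Unique xs → xs ⊆ ys → length xs ≤ length ys
unique-⊆⇒length≤ {xs = xs} {ys} xs! xs⊆ys = injective⇒≤ {f = position} injective
  where
  position : Fin (length xs) → Fin (length ys)
  position i = Any.index (xs⊆ys (∈-lookup i))

  injective : Injective _≡_ _≡_ position
  injective {i} {j} eq = lookup-injective xs! (trans (lookup-index (xs⊆ys (∈-lookup i)))
    (trans (cong (lookup ys) eq) (sym (lookup-index (xs⊆ys (∈-lookup j))))))

two-distinct : {xs : List A} → Unique xs → 2 ≤ length xs → ∃₂ λ x y → x ∈ xs × y ∈ xs × x ≢ y
two-distinct {xs = _ ∷ []}    _              (s≤s ())
two-distinct {xs = x ∷ y ∷ _} ((x≢y ∷ _) ∷ _) _ = x , y , here refl , there (here refl) , x≢y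

filter-length-+ : {P : Pred A 0ℓ} (P? : U.Decidable P) (xs : List A) →
  length (filter P? xs) + length (filter (¬? ∘ P?) xs) ≡ length xs
filter-length-+ P? []       = refl
filter-length-+ P? (x ∷ xs) with P? x
... | yes _ = cong suc (filter-length-+ P? xs)
... | no  _ = trans (+-suc _ _) (cong suc (filter-length-+ P? xs))

-- Serves to evaluate `c` on an edgeless induced subgraph, where being joined is equality and each
-- vertex is its own component.
deduplicate-unique : {R : Rel A 0ℓ} (R? : Decidable R) {xs : List A} → Unique xs →
  (∀ {x y} → x ∈ xs → y ∈ xs → R x y → x ≡ y) → deduplicate R? xs ≡ xs
deduplicate-unique R? []          _   = refl
deduplicate-unique R? {x ∷ xs} (x∉ ∷ xs!) R⇒≡ = cong (x ∷_) (trans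
  (cong (filter (¬? ∘ R? x)) (deduplicate-unique R? xs! λ p q → R⇒≡ (there p) (there q)))
  (filter-all (¬? ∘ R? x) (All.tabulate λ y∈ r → All.lookup x∉ y∈ (R⇒≡ (here refl) (there y∈) r))))

module _ {P : Pred (Fin n) 0ℓ} (P? : U.Decidable P) where

  comprehension : Subset n
  comprehension = tabulate (does ∘ P?)

  ∈-comprehension⁺ : ∀ {x} → P x → x ∈ˢ comprehension
  ∈-comprehension⁺ {x} px =
    lookup⇒[]= x _ (trans (lookup∘tabulate (does ∘ P?) x) (dec-true (P? x) px))

  ∈-comprehension⁻ : ∀ {x} → x ∈ˢ comprehension → P x
  ∈-comprehension⁻ {x} x∈ with P? x | trans (sym (lookup∘tabulate (does ∘ P?) x)) ([]=⇒lookup x∈)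
  ... | yes px | _ = px
  ... | no _   | ()

elements : Subset n → List (Fin n)
elements []            = []
elements (inside  ∷ S) = zero ∷ map suc (elements S)
elements (outside ∷ S) = map suc (elements S)

length-elements : (S : Subset n) → length (elements S) ≡ ∣ S ∣
length-elements []            = refl
length-elements (inside  ∷ S) = cong suc (trans (length-map suc (elements S)) (length-elements S))
length-elements (outside ∷ S) = trans (length-map suc (elements S)) (length-elements S)

elements-unique : (S : Subset n) → Unique (elements S)
elements-unique []            = []
elements-unique (inside  ∷ S) =
  All.tabulate (λ y∈ → λ { refl → case ∈-map⁻ suc y∈ of λ { (_ , _ , ()) } })
  ∷ Unique.map⁺ suc-injective (elements-unique S)
elements-unique (outside ∷ S) = Unique.map⁺ suc-injective (elements-unique S)

∈-elements : (S : Subset n) {x : Fin n} → x ∈ elements S → x ∈ˢ S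
∈-elements (inside  ∷ S) (here refl) = Vec.here
∈-elements (inside  ∷ S) (there x∈)  with _ , y∈ , refl ← ∈-map⁻ suc x∈ = Vec.there (∈-elements S y∈)
∈-elements (outside ∷ S) x∈          with _ , y∈ , refl ← ∈-map⁻ suc x∈ = Vec.there (∈-elements S y∈)

∣∣≤length : (S : Subset n) {xs : List (Fin n)} → (∀ {x} → x ∈ˢ S → x ∈ xs) → ∣ S ∣ ≤ length xs
∣∣≤length S S⊆xs = subst (_≤ _) (length-elements S)
  (unique-⊆⇒length≤ (elements-unique S) (S⊆xs ∘ ∈-elements S))

∈-subsets : (S : Subset n) → S ∈ subsets n
∈-subsets []            = here refl
∈-subsets (inside  ∷ S) = ∈-++⁺ˡ (∈-map⁺ _ (∈-subsets S))
∈-subsets (outside ∷ S) = ∈-++⁺ʳ (map (inside ∷_) (subsets _)) (∈-map⁺ _ (∈-subsets S))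

-- Toughness and the number of components

1</⇒< : (s d : ℕ) .{{_ : NonZero d}} → 1ℚ ℚ.< (+ s) ℚ./ d → d < s
1</⇒< s d@(suc d-1) 1<s/d
  -- Passing to unnormalised fractions undoes the reduction to lowest terms, so the inequality
  -- becomes the cross product `1 * d < s * 1`.
  with ℚᵘ.*<* lt ← ℚᵘ.<-respʳ-≃ (ℚ.toℚᵘ-fromℚᵘ (ℚᵘ.mkℚᵘ (+ s) d-1)) (ℚ.toℚᵘ-mono-< 1<s/d)
  = ℤ.drop‿+<+ (subst (ℤ._< + s) (ℤ.*-identityˡ (+ d)) (subst (ℤ._<_ _) (ℤ.*-identityʳ (+ s)) lt))

module _ (G : Graph (Fin n)) where

  -- For incomplete `G`, `τ G` is a minimum over a list that contains `ratio G S`; for admissible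
  -- `S` that ratio is therefore above 1.
  1<τ⇒c<∣∣ : [ 1ℚ ] <∞ τ G → ¬ Complete G → (S : Subset n) → 2 ≤ c G (∁ S) → c G (∁ S) < ∣ S ∣
  1<τ⇒c<∣∣ 1<τ incomplete S 2≤c with complete? G
  ... | yes complete = contradiction complete incomplete
  ... | no  _ = go (below (min≤ (ratio G S) (∈-map⁺ (ratio G) (∈-subsets S))) 1<τ)
    where
    open Data.List.Extrema ℚ∞-totalOrder using (min; min≤xs)

    min≤ : ∀ r {rs} → r ∈ rs → min ∞ rs ≤⁺ r
    min≤ r r∈ = All.lookup (min≤xs ∞ _) r∈

    below : ∀ {q r} → q ≤⁺ r → [ 1ℚ ] <∞ q → [ 1ℚ ] <∞ r
    below [ q≤r ]  [ 1<q ] = [ ℚ.<-≤-trans 1<q q≤r ]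
    below (_ ≤⊤⁺) [ _ ]    = [ _ ]<⊤⁺
    below (_ ≤⊤⁺) [ _ ]<⊤⁺ = [ _ ]<⊤⁺

    go : [ 1ℚ ] <∞ ratio G S → c G (∁ S) < ∣ S ∣
    go lt with 2 ≤? c G (∁ S)
    go [ lt ] | yes 2≤c′ = 1</⇒< ∣ S ∣ (c G (∁ S)) {{>-nonZero (<-≤-trans 0<1+n 2≤c′)}} lt
    go _      | no 2≰c  = contradiction 2≤c 2≰c

  -- Without edges in `U` being joined is equality, so deduplication discards nothing and `c G U`
  -- counts all of `U`.
  independent-length≤c : {U : Subset n} → (∀ {u v} → u ∈ˢ U → v ∈ˢ U → ¬ Adj G u v) →
    {xs : List (Fin n)} → Unique xs → All (_∈ˢ U) xs → length xs ≤ c G U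
  independent-length≤c {U} independent xs! xs⊆U =
    subst (λ l → _ ≤ length l) (sym (deduplicate-unique (joined? G U) verts! λ _ _ → joined⇒≡))
      (unique-⊆⇒length≤ xs! λ x∈ → ∈-filter⁺ (_∈? U) (∈-allFin _) (All.lookup xs⊆U x∈))
    where
    verts! : Unique (filter (_∈? U) (allFin n))
    verts! = Unique.filter⁺ (_∈? U) (Unique.allFin⁺ n)

    joined⇒≡ : ∀ {u v} → Joined G U u v → u ≡ v
    joined⇒≡ ε                   = refl
    joined⇒≡ ((u∈ , v∈ , uv) ◅ _) = contradiction uv (independent u∈ v∈)

-- Search for a longest list with a decidable property

_∈ˡ?_ : (x : Fin n) (xs : List (Fin n)) → Dec (x ∈ xs)
x ∈ˡ? xs = Any.any? (x ≟_) xs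

any-list? : {Q : List (Fin n) → Set} → U.Decidable Q → ∀ m → Dec (∃ λ xs → length xs ≡ m × Q xs)
any-list? Q? zero    = map′ (λ q → [] , refl , q) (λ { ([] , _ , q) → q }) (Q? [])
any-list? Q? (suc m) = map′
  (λ { (x , xs , eq , q) → x ∷ xs , cong suc eq , q })
  (λ { (x ∷ xs , eq , q) → x , xs , cong pred eq , q })
  (any? λ x → any-list? (λ xs → Q? (x ∷ xs)) m)

-- The search descends from `m`: if no list of length `m` satisfies `Q`, the bound drops by one.
longest-list : {Q : List (Fin n) → Set} → U.Decidable Q → ∀ m → (∀ {xs} → Q xs → length xs ≤ m) →
  ∃ Q → ∃ λ xs → Q xs × (∀ {ys} → Q ys → length ys ≤ length xs)
longest-list Q? m bound q with any-list? Q? m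
... | yes (xs , refl , qxs) = xs , qxs , bound
longest-list Q? zero    bound (xs , q) | no none = contradiction (xs , n≤0⇒n≡0 (bound q) , q) none
longest-list Q? (suc m) bound q        | no none =
  longest-list Q? m (λ {xs} qxs → s≤s⁻¹ (≤∧≢⇒< (bound qxs) λ eq → none (xs , eq , qxs))) q

-- Walks, paths and their cuts

module Walks {n : ℕ} (G : Graph (Fin n)) where

  private
    variable
      a b u v x y x′ y′ : Fin n
      p q : List (Fin n)

  infixr 5 _∷_

  -- The vertex list is an index, so a rerouted walk shows its list as a concatenation that can be
  -- compared with the old one up to permutation.
  data Walk : Fin n → Fin n → List (Fin n) → Set where
    stop : Walk u u (u ∷ [])
    _∷_  : Adj G u v → Walk v x p → Walk u x (u ∷ p)

  join : Walk u x p → Adj G x y → Walk y v q → Walk u v (p ++ q)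
  join stop    e w′ = e ∷ w′
  join (d ∷ w) e w′ = d ∷ join w e w′

  rev : Walk u v p → Walk v u (reverse p)
  rev stop                    = stop
  rev (_∷_ {u = u} {p = p} e w) =
    subst (Walk _ _) (sym (unfold-reverse u p)) (join (rev w) (adj-sym G e) stop)

  walk-head : Walk u v (x ∷ p) → u ≡ x
  walk-head stop    = refl
  walk-head (_ ∷ _) = refl

  start∈ : Walk u v p → u ∈ p
  start∈ stop    = here refl
  start∈ (_ ∷ _) = here refl

  walk? : ∀ u v p → Dec (Walk u v p)
  walk? u v []          = no λ ()
  walk? u v (x ∷ [])    = map′ (λ { (refl , refl) → stop }) (λ { stop → refl , refl ; (_ ∷ ()) })
    ((u ≟ x) ×-dec (u ≟ v))
  walk? u v (x ∷ y ∷ p) = map′ (λ { (refl , e , w) → e ∷ w }) from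
    ((u ≟ x) ×-dec adj? G u y ×-dec walk? y v (y ∷ p))
    where
    from : Walk u v (x ∷ y ∷ p) → u ≡ x × Adj G u y × Walk y v (y ∷ p)
    from (e ∷ w) with refl ← walk-head w = refl , e , w

  Path : Fin n → Fin n → List (Fin n) → Set
  Path u v p = Walk u v p × Unique p

  path? : ∀ u v → U.Decidable (Path u v)
  path? u v p = walk? u v p ×-dec allPairs? (λ x y → ¬? (x ≟ y)) p

  walk⇒linked : Walk u v p → Linked (Adj G) p
  walk⇒linked stop            = [-]
  walk⇒linked (e ∷ stop)      = e ∷ [-]
  walk⇒linked (e ∷ w@(_ ∷ _)) = e ∷ walk⇒linked w

  walk⇒head : Walk u v p → head p ≡ just u
  walk⇒head stop    = refl
  walk⇒head (_ ∷ _) = refl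

  walk⇒head-++ : Walk u v p → head (p ++ q) ≡ just u
  walk⇒head-++ stop    = refl
  walk⇒head-++ (_ ∷ _) = refl

  walk⇒last : Walk u v p → last p ≡ just v
  walk⇒last stop            = refl
  walk⇒last (_ ∷ stop)      = refl
  walk⇒last (_ ∷ w@(_ ∷ _)) = walk⇒last w

  path⇒isPath : Path u v p → IsPath G u v p
  path⇒isPath (w , p!) = record
    { starts = walk⇒head w ; ends = walk⇒last w ; linked = walk⇒linked w ; distinct = p! }

  suffix : {P : Pred (Fin n) 0ℓ} → Path u v p → All P p → x ∈ p → ∃ λ q → Path x v q × All P q
  suffix (stop , p!)       ps       (here refl) = _ , (stop , p!) , ps
  suffix (w@(_ ∷ _) , p!)  ps       (here refl) = _ , (w , p!) , ps
  suffix (_ ∷ w , _ ∷ p!) (_ ∷ ps) (there x∈)  = suffix (w , p!) ps x∈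

  -- Loops are removed on the way: if the new first vertex already occurs later, the suffix starting
  -- there is used instead. The last component records that the path stays among vertices reachable
  -- from `u`.
  star⇒path : {R : Rel (Fin n) 0ℓ} → (∀ {u v} → R u v → Adj G u v) → Star R u v →
    ∃ λ p → Path u v p × All (Star R u) p
  star⇒path R⇒Adj ε = _ , (stop , [] ∷ []) , ε ∷ []
  star⇒path {u = u} R⇒Adj (r ◅ rs) with p , (w , p!) , ps ← star⇒path R⇒Adj rs | u ∈ˡ? p
  ... | yes u∈p = suffix (w , p!) (All.map (r ◅_) ps) u∈p
  ... | no  u∉p = _ , (R⇒Adj r ∷ w , All.tabulate (λ { z∈ refl → u∉p z∈ }) ∷ p!) , ε ∷ All.map (r ◅_) ps

  -- An edge of `p`, traversed from `x` to `y`, with the two pieces left by its removal.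
  record Cut (a b : Fin n) (p : List (Fin n)) (x y : Fin n) : Set where
    constructor cut
    field
      {before after} : List (Fin n)
      walk₁ : Walk a x before
      step  : Adj G x y
      walk₂ : Walk y b after
      parts : p ≡ before ++ after

  extend : Adj G u v → Cut v b p x y → Cut u b (u ∷ p) x y
  extend e (cut w₁ d w₂ refl) = cut (e ∷ w₁) d w₂ refl

  cut∈ : Cut a b p x y → y ∈ p
  cut∈ (cut stop    _ w₂ refl) = there (start∈ w₂)
  cut∈ (cut (_ ∷ w) d w₂ refl) = there (cut∈ (cut w d w₂ refl))

  -- Relative position of two cuts of one list; `γ` is the segment between the two removed edges.
  data Compare (α β α′ β′ : List (Fin n)) (x y x′ y′ : Fin n) : Set where
    same   : y ≡ y′ → Compare α β α′ β′ x y x′ y′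
    first  : ∀ {γ} → Walk y x′ γ → α′ ≡ α ++ γ → β ≡ γ ++ β′ → Compare α β α′ β′ x y x′ y′
    second : ∀ {γ} → Walk y′ x γ → α ≡ α′ ++ γ → β′ ≡ γ ++ β → Compare α β α′ β′ x y x′ y′

  compare : ∀ {α β α′ β′} → Walk a x α → Walk y b β → Walk a x′ α′ → Walk y′ b β′ →
    α ++ β ≡ α′ ++ β′ → Compare α β α′ β′ x y x′ y′
  compare stop w₂ stop w₂′ eq with refl ← ∷-injectiveʳ eq =
    same (just-injective (trans (sym (walk⇒head w₂)) (walk⇒head w₂′)))
  compare stop w₂ (_ ∷ w₁′) w₂′ eq with refl ← ∷-injectiveʳ eq
    with refl ← just-injective (trans (sym (walk⇒head w₂)) (walk⇒head-++ w₁′)) =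
    first w₁′ refl refl
  compare (_ ∷ w₁) w₂ stop w₂′ eq with refl ← ∷-injectiveʳ eq
    with refl ← just-injective (trans (sym (walk⇒head w₂′)) (walk⇒head-++ w₁)) =
    second w₁ refl refl
  compare (_ ∷ w₁) w₂ (_ ∷ w₁′) w₂′ eq
    with refl ← just-injective (trans (sym (walk⇒head-++ w₁))
                  (trans (cong head (∷-injectiveʳ eq)) (walk⇒head-++ w₁′)))
    with compare w₁ w₂ w₁′ w₂′ (∷-injectiveʳ eq)
  ... | same eq′          = same eq′
  ... | first  w refl eq′ = first  w refl eq′
  ... | second w refl eq′ = second w refl eq′

  -- Removal of two edges of `p`, `xy` before `x′y′`. The second edge is stored so that `order³` can
  -- glue `β` and `γ` together again.
  record Cut² (a b : Fin n) (p : List (Fin n)) (x y x′ y′ : Fin n) : Set where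
    constructor cut²
    field
      {α β γ} : List (Fin n)
      walk₁ : Walk a x α
      walk₂ : Walk y x′ β
      step  : Adj G x′ y′
      walk₃ : Walk y′ b γ
      parts : p ≡ α ++ β ++ γ

  record Cut³ (a b : Fin n) (p : List (Fin n)) (x y x′ y′ x″ y″ : Fin n) : Set where
    constructor cut³
    field
      {α β γ δ} : List (Fin n)
      walk₁ : Walk a x α
      walk₂ : Walk y x′ β
      walk₃ : Walk y′ x″ γ
      walk₄ : Walk y″ b δ
      parts : p ≡ α ++ β ++ γ ++ δ

  order² : Cut a b p x y → Cut a b p x′ y′ → y ≢ y′ →
    Cut² a b p x y x′ y′ ⊎ Cut² a b p x′ y′ x y
  order² (cut w₁ e w₂ refl) (cut w₁′ e′ w₂′ eq) y≢y′ with compare w₁ w₂ w₁′ w₂′ eq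
  ... | same y≡y′           = contradiction y≡y′ y≢y′
  ... | first  w refl refl = inj₁ (cut² w₁ w e′ w₂′ refl)
  ... | second w refl refl = inj₂ (cut² w₁′ w e w₂ eq)

  -- The third cut is compared with the first and, if it lies beyond, with the second on the rest of
  -- the path.
  order³ : ∀ {u u⁺} → Cut² a b p x y x′ y′ → Cut a b p u u⁺ → y ≢ u⁺ → y′ ≢ u⁺ →
    Cut³ a b p u u⁺ x y x′ y′ ⊎ Cut³ a b p x y u u⁺ x′ y′ ⊎ Cut³ a b p x y x′ y′ u u⁺
  order³ (cut² {α} {β} {γ} w₁ w₂ e w₃ refl) (cut wᵤ _ wᵤ⁺ eq) y≢u⁺ y′≢u⁺
    with compare w₁ (join w₂ e w₃) wᵤ wᵤ⁺ eq
  ... | same y≡u⁺           = contradiction y≡u⁺ y≢u⁺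
  ... | second w refl refl = inj₁ (cut³ wᵤ w w₂ w₃ eq)
  ... | first  w refl eq′ with compare w₂ w₃ w wᵤ⁺ eq′
  ...   | same y′≡u⁺               = contradiction y′≡u⁺ y′≢u⁺
  ...   | first  w′ refl refl      = inj₂ (inj₂ (cut³ w₁ w₂ w′ wᵤ⁺ refl))
  ...   | second {δ} w′ refl refl = inj₂ (inj₁ (cut³ w₁ w w′ w₃ (cong (α ++_) (++-assoc _ δ γ))))

-- Graphs without P₂ ∪ kP₁

P₁-edgeless : ∀ {u v} → ¬ Adj (P 1) u v
P₁-edgeless {zero} {zero} (inj₁ ())
P₁-edgeless {zero} {zero} (inj₂ ())

free⇒few-non-neighbours : {V : Set} (G : Graph V) → G IsFree (P 2 ∪ k · P 1) →
  ∀ {u v xs} → Adj G u v → Unique xs → (∀ {x y} → x ∈ xs → y ∈ xs → ¬ Adj G x y) →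
  All (λ x → ¬ Adj G u x × ¬ Adj G v x) xs → length xs < k
free⇒few-non-neighbours {k} {V} G free {u} {v} {xs} uv xs! independent far =
  ≰⇒> λ k≤∣xs∣ → free (copy k≤∣xs∣)
  where
  module _ (k≤∣xs∣ : k ≤ length xs) where

    pick : Fin k → V
    pick i = lookup xs (inject≤ i k≤∣xs∣)

    u≁ : ∀ i → ¬ Adj G u (pick i)
    u≁ i = proj₁ (All.lookup far (∈-lookup (inject≤ i k≤∣xs∣)))

    v≁ : ∀ i → ¬ Adj G v (pick i)
    v≁ i = proj₂ (All.lookup far (∈-lookup (inject≤ i k≤∣xs∣)))

    embed : Fin 2 ⊎ (Fin k × Fin 1) → V
    embed (inj₁ zero)       = u
    embed (inj₁ (suc zero)) = v
    embed (inj₂ (i , _))    = pick i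

    -- `v` tells the two apart: it is adjacent to `u` but not to `pick i`.
    u≢ : ∀ i → u ≢ pick i
    u≢ i eq = v≁ i (subst (Adj G v) eq (adj-sym G uv))

    v≢ : ∀ i → v ≢ pick i
    v≢ i eq = u≁ i (subst (Adj G u) eq uv)

    u≢v : u ≢ v
    u≢v refl = no-loop G uv

    injective : Injective _≡_ _≡_ embed
    injective {inj₁ zero}       {inj₁ zero}       _  = refl
    injective {inj₁ zero}       {inj₁ (suc zero)} eq = contradiction eq u≢v
    injective {inj₁ (suc zero)} {inj₁ zero}       eq = contradiction (sym eq) u≢v
    injective {inj₁ (suc zero)} {inj₁ (suc zero)} _  = refl
    injective {inj₁ zero}       {inj₂ (i , _)}    eq = contradiction eq (u≢ i)
    injective {inj₁ (suc zero)} {inj₂ (i , _)}    eq = contradiction eq (v≢ i)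
    injective {inj₂ (i , _)}    {inj₁ zero}       eq = contradiction (sym eq) (u≢ i)
    injective {inj₂ (i , _)}    {inj₁ (suc zero)} eq = contradiction (sym eq) (v≢ i)
    injective {inj₂ (i , zero)} {inj₂ (j , zero)} eq =
      cong (λ i → inj₂ (i , zero)) (inject≤-injective _ _ i j (lookup-injective xs! eq))

    none : {B C : Set} → ¬ B → ¬ C → B ⇔ C
    none ¬b ¬c = mk⇔ (λ b → contradiction b ¬b) (λ c → contradiction c ¬c)

    adj⇔ : ∀ s t → Adj (P 2 ∪ k · P 1) s t ⇔ Adj G (embed s) (embed t)
    adj⇔ (inj₁ zero)       (inj₁ zero)       = none (no-loop (P 2 ∪ k · P 1)) (no-loop G)
    adj⇔ (inj₁ zero)       (inj₁ (suc zero)) = mk⇔ (λ _ → uv) (λ _ → inj₁ (inj₁ refl))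
    adj⇔ (inj₁ (suc zero)) (inj₁ zero)       = mk⇔ (λ _ → adj-sym G uv) (λ _ → inj₁ (inj₂ refl))
    adj⇔ (inj₁ (suc zero)) (inj₁ (suc zero)) = none (no-loop (P 2 ∪ k · P 1)) (no-loop G)
    adj⇔ (inj₁ zero)       (inj₂ (i , _))    = none (λ ()) (u≁ i)
    adj⇔ (inj₁ (suc zero)) (inj₂ (i , _))    = none (λ ()) (v≁ i)
    adj⇔ (inj₂ (i , _))    (inj₁ zero)       = none (λ ()) (u≁ i ∘ adj-sym G)
    adj⇔ (inj₂ (i , _))    (inj₁ (suc zero)) = none (λ ()) (v≁ i ∘ adj-sym G)
    adj⇔ (inj₂ (i , _))    (inj₂ (j , _))    =
      none (λ { (inj₂ (_ , e)) → P₁-edgeless e }) (independent (∈-lookup _) (∈-lookup _))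

    copy : InducedCopy (P 2 ∪ k · P 1) G
    copy = record { embed = embed ; injective = injective ; adj⇔ = adj⇔ }

module Domination {n k : ℕ} (G : Graph (Fin n)) (free : G IsFree (P 2 ∪ k · P 1))
  {I : List (Fin n)} (I! : Unique I) (independent : ∀ {x y} → x ∈ I → y ∈ I → ¬ Adj G x y)
  (2k≤∣I∣ : 2 * k ≤ length I) where

  Dominated : Pred (Fin n) 0ℓ
  Dominated u = Any (Adj G u) I

  dominated? : U.Decidable Dominated
  dominated? u = Any.any? (adj? G u) I

  undominated : ∀ {x} → x ∈ I → ¬ Dominated x
  undominated x∈ d with _ , y∈ , xy ← find d = independent x∈ y∈ xy

  -- A neighbour `v` of `u` in `I` misses all of `I` by independence, so the edge `uv` misses every
  -- non-neighbour of `u` in `I`.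
  few-non-neighbours : ∀ {u} → Dominated u → length (filter (¬? ∘ adj? G u) I) < k
  few-non-neighbours {u} d with v , v∈ , uv ← find d =
    free⇒few-non-neighbours G free uv (Unique.filter⁺ _ I!)
      (λ x∈ y∈ → independent (proj₁ (∈-filter⁻ _ {xs = I} x∈)) (proj₁ (∈-filter⁻ _ {xs = I} y∈)))
      (All.tabulate λ x∈ → proj₂ (∈-filter⁻ (¬? ∘ adj? G u) {xs = I} x∈)
        , independent v∈ (proj₁ (∈-filter⁻ _ {xs = I} x∈)))

  -- An edge between undominated vertices would miss all of `I`, which has at least `k` vertices.
  undominated-independent : .{{_ : NonZero k}} → ∀ {u v} → ¬ Dominated u → ¬ Dominated v → ¬ Adj G u v
  undominated-independent ¬du ¬dv uv = <⇒≱
    (free⇒few-non-neighbours G free uv I! independent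
      (All.tabulate λ x∈ → ¬du ∘ lose x∈ , ¬dv ∘ lose x∈))
    (≤-trans (m≤m+n k _) 2k≤∣I∣)

  module _ {u v} (du : Dominated u) (dv : Dominated v) where

    private
      N[u] common missed : List (Fin n)
      N[u]   = filter (adj? G u) I
      common = filter (adj? G v) N[u]
      missed = filter (¬? ∘ adj? G v) N[u]

      ∈-common : ∀ {x} → x ∈ common → x ∈ I × Adj G u x × Adj G v x
      ∈-common x∈
        with x∈N , vx ← ∈-filter⁻ (adj? G v) {xs = N[u]} x∈
        with x∈I , ux ← ∈-filter⁻ (adj? G u) {xs = I} x∈N =
        x∈I , ux , vx

      missed<k : length missed < k
      missed<k = ≤-<-trans (unique-⊆⇒length≤ (Unique.filter⁺ _ (Unique.filter⁺ _ I!)) missed⊆)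
        (few-non-neighbours dv)
        where
        missed⊆ : missed ⊆ filter (¬? ∘ adj? G v) I
        missed⊆ x∈ with x∈N , ¬vx ← ∈-filter⁻ (¬? ∘ adj? G v) {xs = N[u]} x∈ =
          ∈-filter⁺ (¬? ∘ adj? G v) (proj₁ (∈-filter⁻ (adj? G u) {xs = I} x∈N)) ¬vx

      -- Of at least `2k` vertices of `I`, each of `u` and `v` misses at most `k - 1`; the two
      -- strict bounds supply the 2.
      2≤∣common∣ : 2 ≤ length common
      2≤∣common∣ = +-cancelʳ-≤ (length missed + length others) 2 (length common) (begin
        2 + (length missed + length others)             ≡⟨ cong suc (+-suc _ _) ⟨
        suc (length missed) + suc (length others)       ≤⟨ +-mono-≤ missed<k (few-non-neighbours du) ⟩
        k + k                                           ≡⟨ cong (_+_ k) (+-identityʳ k) ⟨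
        2 * k                                           ≤⟨ 2k≤∣I∣ ⟩
        length I                                        ≡⟨ filter-length-+ (adj? G u) I ⟨
        length N[u] + length others                     ≡⟨ cong (_+ length others) (filter-length-+ (adj? G v) N[u]) ⟨
        (length common + length missed) + length others ≡⟨ +-assoc (length common) _ _ ⟩
        length common + (length missed + length others) ∎)
        where
        open ≤-Reasoning
        others : List (Fin n)
        others = filter (¬? ∘ adj? G u) I

    common-neighbours :
      ∃₂ λ x y → (x ∈ I × Adj G u x × Adj G v x) × (y ∈ I × Adj G u y × Adj G v y) × x ≢ y
    common-neighbours
      with x , y , x∈ , y∈ , x≢y ←
             two-distinct (Unique.filter⁺ (adj? G v) (Unique.filter⁺ (adj? G u) I!)) 2≤∣common∣
      = x , y , ∈-common x∈ , ∈-common y∈ , x≢y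

-- Successors and consecutive vertices along a path

module _ {P : Pred A 0ℓ} (P? : U.Decidable P) where

  successors : List A → List A
  successors []          = []
  successors (_ ∷ [])    = []
  successors (x ∷ y ∷ p) =
    if does (P? x) then y ∷ successors (y ∷ p) else successors (y ∷ p)

  successors⊆ : ∀ {x} p → successors (x ∷ p) ⊆ p
  successors⊆ {x} (y ∷ p) z∈ with P? x | z∈
  ... | yes _ | here refl = here refl
  ... | yes _ | there z∈′ = there (successors⊆ p z∈′)
  ... | no  _ | z∈′       = there (successors⊆ p z∈′)

  successors-unique : ∀ {p} → Unique p → Unique (successors p)
  successors-unique []        = []
  successors-unique (_ ∷ p!) = tail-unique _ p!
    where
    tail-unique : ∀ x {p} → Unique p → Unique (successors (x ∷ p))
    tail-unique x []                  = []
    tail-unique x (_∷_ {x = y} y∉p p!) with P? x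
    ... | yes _ = All.tabulate (All.lookup y∉p ∘ successors⊆ _) ∷ tail-unique y p!
    ... | no  _ = tail-unique y p!

  -- Only the last entry of the list has no successor, whence the extra one.
  filter≤1+successors : ∀ p → length (filter P? p) ≤ suc (length (successors p))
  filter≤1+successors []      = z≤n
  filter≤1+successors (x ∷ p) = go x p
    where
    go : ∀ x p → length (filter P? (x ∷ p)) ≤ suc (length (successors (x ∷ p)))
    go x []      with P? x
    ... | yes _ = s≤s z≤n
    ... | no  _ = z≤n
    go x (y ∷ p) with P? x
    ... | yes _ = s≤s (go y p)
    ... | no  _ = go y p

module _ (G : Graph (Fin n)) {P : Pred (Fin n) 0ℓ} (P? : U.Decidable P) where
  open Walks G

  successor-cut : ∀ {a b p y} → Walk a b p → y ∈ successors P? p → ∃ λ x → Cut a b p x y × P x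
  successor-cut {a} (_∷_ {p = y ∷ p} e w) y∈ with refl ← walk-head w | P? a | y∈
  ... | yes pa | here refl = a , cut stop e w refl , pa
  ... | yes _  | there y∈′ with x , c , px ← successor-cut w y∈′ = x , extend e c , px
  ... | no  _  | y∈′       with x , c , px ← successor-cut w y∈′ = x , extend e c , px

  -- If no two consecutive vertices satisfy `P`, every two such vertices are separated by one that
  -- does not, so they exceed the others by at most one.
  consecutive : ∀ {a b p} → Walk a b p → suc (length (filter (¬? ∘ P?) p)) < length (filter P? p) →
    ∃₂ λ x y → Cut a b p x y × P x × P y
  consecutive w more = Sum.[ id , (λ bounds → contradiction (proj₁ bounds) (<⇒≱ more)) ]′ (go w)
    where
    -- The induction needs the sharper bound, without the extra one, for walks whose first vertex
    -- fails `P`.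
    go : ∀ {a b p} → Walk a b p → (∃₂ λ x y → Cut a b p x y × P x × P y) ⊎
      (length (filter P? p) ≤ suc (length (filter (¬? ∘ P?) p)) ×
       (¬ P a → length (filter P? p) ≤ length (filter (¬? ∘ P?) p)))
    go {a} stop with P? a
    ... | yes pa = inj₂ (s≤s z≤n , contradiction pa)
    ... | no  _  = inj₂ (z≤n , λ _ → z≤n)
    go {a} (_∷_ {v = v} e w) with go w
    ... | inj₁ (x , y , c , pxy) = inj₁ (x , y , extend e c , pxy)
    ... | inj₂ (bound , bound′) with P? a
    ...   | no _   = inj₂ (m≤n⇒m≤1+n bound , λ _ → bound)
    ...   | yes pa with P? v
    ...     | yes pv  = inj₁ (a , v , cut stop e w refl , pa , pv)
    ...     | no  ¬pv = inj₂ (s≤s (bound′ ¬pv) , contradiction pa)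

-- A longest path missing a vertex

module Maximal (G : Graph (Fin n)) {a b p} (path : Walks.Path G a b p) (a≢b : a ≢ b)
  (longest : ∀ {q} → Walks.Path G a b q → length q ≤ length p) {w} (w∉p : w ∉ p) where

  open Walks G

  Off : Rel (Fin n) 0ℓ
  Off u v = u ∉ p × v ∉ p × Adj G u v

  off-sym : Symmetric Off
  off-sym (u∉ , v∉ , uv) = v∉ , u∉ , adj-sym G uv

  -- The component of `w` in the graph with `p` deleted.
  H : Pred (Fin n) 0ℓ
  H = Star Off w

  H? : U.Decidable H
  H? = star? (λ u v → ¬? (u ∈ˡ? p) ×-dec ¬? (v ∈ˡ? p) ×-dec adj? G u v) w

  star-off : ∀ {u v} → u ∉ p → Star Off u v → v ∉ p
  star-off u∉ ε                  = u∉
  star-off u∉ ((_ , v∉ , _) ◅ s) = star-off v∉ s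

  H-off : ∀ {v} → H v → v ∉ p
  H-off = star-off w∉p

  Attached : Pred (Fin n) 0ℓ
  Attached x = ∃ λ h → H h × Adj G h x

  attached? : U.Decidable Attached
  attached? x = any? λ h → H? h ×-dec adj? G h x

  record Bridge (x y : Fin n) : Set where
    field
      {h h′} : Fin n
      {hs}   : List (Fin n)
      enter  : Adj G x h
      walk   : Walk h h′ hs
      leave  : Adj G h′ y
      unique : Unique hs
      within : All H hs

    link : ∀ {u v α β} → Walk u x α → Walk y v β → Walk u v (α ++ hs ++ β)
    link w₁ w₂ = join w₁ enter (join walk leave w₂)

    nonempty : 0 < length hs
    nonempty = ∈-length (start∈ walk)

  bridge : ∀ {x y} → Attached x → Attached y → Bridge x y
  bridge (h , hh , hx) (h′ , hh′ , h′y)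
    with hs , (w′ , hs!) , within ← star⇒path (λ (_ , _ , e) → e) (Star.reverse off-sym hh ◅◅ hh′)
    = record { enter = adj-sym G hx ; walk = w′ ; leave = h′y ; unique = hs!
             ; within = All.map (hh ◅◅_) within }

  -- Every rerouting is refuted here: a walk that permutes `p` together with new distinct vertices
  -- is again a path, and longer than `p`.
  not-longer : ∀ {q es} → 0 < length es → Unique es → All (_∉ p) es → Walk a b q → ¬ (q ↭ es ++ p)
  not-longer {q} {es} 0< es! es∉ w′ q↭ = <⇒≱ longer (longest (w′ , q!))
    where
    q! : Unique q
    q! = Unique-resp-↭ (setoid (Fin n)) (↭⇒↭ₛ (↭-sym q↭))
      (Unique.++⁺ es! (proj₂ path) λ (z∈es , z∈p) → All.lookup es∉ z∈es z∈p)

    longer : length p < length q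
    longer = subst (length p <_) (sym (trans (↭-length q↭) (length-++ es)))
      (+-monoˡ-≤ (length p) 0<)

  module _ {x y} (B : Bridge x y) where
    open Bridge B

    no-bridge : ∀ {q} → Walk a b q → ¬ (q ↭ hs ++ p)
    no-bridge = not-longer nonempty unique (All.map H-off within)

  no-insertion : ∀ {x y} → Cut a b p x y → Attached x → ¬ Attached y
  no-insertion (cut {α} w₁ _ w₂ refl) nx ny = no-bridge B (link w₁ w₂) (shifts α hs)
    where
    B = bridge nx ny
    open Bridge B

  -- The longer path would run `a … x`, through `H` to `x′`, back to `y`, and by the edge `yy′` on
  -- to `b`.
  no-crossing : ∀ {x y x′ y′} → Cut² a b p x y x′ y′ → Attached x → Attached x′ → ¬ Adj G y y′
  no-crossing (cut² {α} {β} {γ} w₁ w₂ _ w₃ refl) nx nx′ yy′ =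
    no-bridge B (link w₁ (join (rev w₂) yy′ w₃))
      (↭-trans (shifts α hs) (++⁺ˡ hs (++⁺ˡ α (++⁺ʳ γ (↭-reverse β)))))
    where
    B = bridge nx nx′
    open Bridge B

  -- As in `no-crossing`, with `y`, `u`, `y′` in place of the edge `yy′`; since `u` is outside `H`,
  -- the bridge does not meet it.
  no-detour : ∀ {x y x′ y′ u} → Cut² a b p x y x′ y′ → Attached x → Attached x′ →
    u ∉ p → ¬ H u → Adj G u y → ¬ Adj G u y′
  no-detour {u = u} (cut² {α} {β} {γ} w₁ w₂ _ w₃ refl) nx nx′ u∉p u∉H uy uy′ =
    not-longer {es = u ∷ hs} z<s
      (All.tabulate (λ { z∈ refl → u∉H (All.lookup within z∈) }) ∷ unique)
      (u∉p ∷ All.map H-off within)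
      (link w₁ (join (rev w₂) (adj-sym G uy) (uy′ ∷ w₃)))
      (↭-trans (++⁺ˡ α (↭-trans (++⁺ˡ hs (shifts (reverse β) (u ∷ []))) (shifts hs (u ∷ []))))
        (↭-trans (shifts α (u ∷ []))
          (prep u (↭-trans (shifts α hs) (++⁺ˡ hs (++⁺ˡ α (++⁺ʳ γ (↭-reverse β))))))))
    where
    B = bridge nx nx′
    open Bridge B

  -- Wherever the edge `uv` of `p` lies relative to `xy` and `x′y′`, two of the four adjacencies
  -- allow a rerouting through `H`.
  no-triple : ∀ {x y x′ y′ u v} →
    Cut³ a b p u v x y x′ y′ ⊎ Cut³ a b p x y u v x′ y′ ⊎ Cut³ a b p x y x′ y′ u v →
    Attached x → Attached x′ → Adj G u y → Adj G v y → Adj G u y′ → ¬ Adj G v y′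
  -- New order: `a … u`, `y … x′`, `H`, `x … v`, `y′ … b`.
  no-triple (inj₁ (cut³ {α} {β} {γ} {δ} w₁ w₂ w₃ w₄ refl)) nx nx′ uy vy uy′ vy′ =
    no-bridge B (join w₁ uy (link w₃ (join (rev w₂) vy′ w₄)))
      (↭-trans (++⁺ˡ α (shifts γ hs)) (↭-trans (shifts α hs) (++⁺ˡ hs (++⁺ˡ α
        (↭-trans (shifts γ (reverse β)) (++⁺ʳ (γ ++ δ) (↭-reverse β)))))))
    where
    B = bridge nx′ nx
    open Bridge B
  -- New order: `a … x`, `H`, `x′ … v`, `y … u`, `y′ … b`.
  no-triple (inj₂ (inj₁ (cut³ {α} {β} {γ} {δ} w₁ w₂ w₃ w₄ refl))) nx nx′ uy vy uy′ vy′ =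
    no-bridge B (link w₁ (join (rev w₃) vy (join w₂ uy′ w₄)))
      (↭-trans (shifts α hs) (++⁺ˡ hs (++⁺ˡ α
        (↭-trans (shifts (reverse γ) β) (++⁺ˡ β (++⁺ʳ δ (↭-reverse γ)))))))
    where
    B = bridge nx nx′
    open Bridge B
  -- New order: `a … x`, `H`, `x′ … y`, `u … y′`, `v … b`.
  no-triple (inj₂ (inj₂ (cut³ {α} {β} {γ} {δ} w₁ w₂ w₃ w₄ refl))) nx nx′ uy vy uy′ vy′ =
    no-bridge B (link w₁ (join (rev w₂) (adj-sym G uy) (join (rev w₃) (adj-sym G vy′) w₄)))
      (↭-trans (shifts α hs) (++⁺ˡ hs (++⁺ˡ α (++⁺ (↭-reverse β) (++⁺ʳ δ (↭-reverse γ))))))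
    where
    B = bridge nx nx′
    open Bridge B

  -- The first two vertices of `p` cannot both be attached, and `a≢b` ensures that there are two.
  unattached : ∃ λ x → x ∈ p × ¬ Attached x
  unattached = from (proj₁ path) refl
    where
    from : ∀ {q} → Walk a b q → p ≡ q → ∃ λ x → x ∈ p × ¬ Attached x
    from stop                  _    = contradiction refl a≢b
    from (_∷_ {v = x} e w′) refl with attached? a | attached? x
    ... | no ¬na | _      = a , here refl , ¬na
    ... | yes _  | no ¬nx = x , there (start∈ w′) , ¬nx
    ... | yes na | yes nx = contradiction nx (no-insertion (cut stop e w′ refl) na)

  -- The attached vertices of `p` separate `w` from an unattached vertex of `p`, so there cannot be
  -- fewer than `m` of them.
  attachments≥ : ∀ {m} → (∀ S → ∣ S ∣ < m → Connected G (∁ S)) → m ≤ length (filter attached? p)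
  attachments≥ {m} connected = ≮⇒≥ λ few →
    let v , v∈p , ¬nv = unattached in
    H-off (closed ε (connected S (≤-<-trans ∣S∣≤ few)
      (x∉p⇒x∈∁p λ w∈S → w∉p (proj₁ (∈-comprehension⁻ S? w∈S)))
      (x∉p⇒x∈∁p λ v∈S → ¬nv (proj₂ (∈-comprehension⁻ S? v∈S))))) v∈p
    where
    S? : U.Decidable (λ x → x ∈ p × Attached x)
    S? x = (x ∈ˡ? p) ×-dec attached? x

    S : Subset n
    S = comprehension S?

    ∣S∣≤ : ∣ S ∣ ≤ length (filter attached? p)
    ∣S∣≤ = ∣∣≤length S λ x∈ → let x∈p , nx = ∈-comprehension⁻ S? x∈ in ∈-filter⁺ attached? x∈p nx

    -- A step from `H` onto `p` would end at an attached vertex, hence in `S`.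
    closed : ∀ {h v} → H h → Joined G (∁ S) h v → H v
    closed hh ε = hh
    closed {h} hh (_◅_ {j = v} (_ , v∈ , e) s) with v ∈ˡ? p
    ... | yes v∈p = contradiction (∈-comprehension⁺ S? (v∈p , h , hh , e)) (x∈∁p⇒x∉p v∈)
    ... | no  v∉p = closed (hh ◅◅ (H-off hh , v∉p , e) ◅ ε) s

  -- `w` makes up for the successor that is lacking when the last vertex `b` is attached.
  I : List (Fin n)
  I = w ∷ successors attached? p

  Successor : Pred (Fin n) 0ℓ
  Successor y = ∃ λ x → Cut a b p x y × Attached x

  successor : ∀ {y} → y ∈ successors attached? p → Successor y
  successor = successor-cut G attached? (proj₁ path)

  ¬H-successor : ∀ {h y} → H h → Successor y → ¬ Adj G h y
  ¬H-successor {h} hh (x , c , nx) hy = no-insertion c nx (h , hh , hy)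

  ¬successors : ∀ {y y′} → Successor y → Successor y′ → ¬ Adj G y y′
  ¬successors (x , c , nx) (x′ , c′ , nx′) yy′ =
    Sum.[ (λ c² → no-crossing c² nx nx′ yy′) , (λ c² → no-crossing c² nx′ nx (adj-sym G yy′)) ]′
      (order² c c′ λ { refl → no-loop G yy′ })

  I-unique : Unique I
  I-unique = All.tabulate (λ { y∈ refl → w∉p (cut∈ (proj₁ (proj₂ (successor y∈)))) })
    ∷ successors-unique attached? (proj₂ path)

  I-independent : ∀ {y y′} → y ∈ I → y′ ∈ I → ¬ Adj G y y′
  I-independent (here refl) (here refl)  = no-loop G
  I-independent (here refl) (there y′∈) = ¬H-successor ε (successor y′∈)
  I-independent (there y∈)  (here refl)  = ¬H-successor ε (successor y∈) ∘ adj-sym G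
  I-independent (there y∈)  (there y′∈) = ¬successors (successor y∈) (successor y′∈)

  -- Dominated vertices against toughness

  module Contradiction {k : ℕ} .{{_ : NonZero k}} (connected : (2 * k) IsConnected G)
    (free : G IsFree (P 2 ∪ k · P 1)) (1<τ : [ 1ℚ ] <∞ τ G) where

    2k≤∣I∣ : 2 * k ≤ length I
    2k≤∣I∣ = ≤-trans (attachments≥ (proj₂ connected)) (filter≤1+successors attached? p)

    2≤∣I∣ : 2 ≤ length I
    2≤∣I∣ = ≤-trans (*-monoʳ-≤ 2 (>-nonZero⁻¹ k)) 2k≤∣I∣

    open Domination G free I-unique I-independent 2k≤∣I∣

    no-common-successors : ∀ {u v y y′} → Cut a b p u v → Successor y → Successor y′ → y ≢ y′ →
      Adj G u y → Adj G v y → Adj G u y′ → ¬ Adj G v y′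
    no-common-successors {v = v} c (x , cy , nx) (x′ , cy′ , nx′) y≢y′ uy vy uy′ vy′ =
      Sum.[ (λ c² → no-triple (order³ c² c y≢v y′≢v) nx nx′ uy vy uy′ vy′)
          , (λ c² → no-triple (order³ c² c y′≢v y≢v) nx′ nx uy′ vy′ uy vy) ]′ (order² cy cy′ y≢y′)
      where
      y≢v : _ ≢ v
      y≢v refl = no-loop G vy
      y′≢v : _ ≢ v
      y′≢v refl = no-loop G vy′

    no-consecutive : ∀ {u v} → Cut a b p u v → Dominated u → ¬ Dominated v
    no-consecutive {u} {v} c du dv = on (common-neighbours du dv)
      where
      on : ¬ (∃₂ λ x y → (x ∈ I × Adj G u x × Adj G v x) × (y ∈ I × Adj G u y × Adj G v y) × x ≢ y)
      -- If `w` is a common neighbour, both ends of the edge `uv` are attached.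
      on (_ , _ , (here refl , uw , vw) , _) = no-insertion c (w , ε , adj-sym G uw) (w , ε , adj-sym G vw)
      on (_ , _ , _ , (here refl , uw , vw) , _) = no-insertion c (w , ε , adj-sym G uw) (w , ε , adj-sym G vw)
      on (_ , _ , (there y∈ , uy , vy) , (there y′∈ , uy′ , vy′) , y≢y′) =
        no-common-successors c (successor y∈) (successor y′∈) y≢y′ uy vy uy′ vy′

    dominated⇒∈p : ∀ {u} → Dominated u → u ∈ p
    dominated⇒∈p {u} du = decidable-stable (u ∈ˡ? p) λ u∉p → off u∉p (H? u) (common-neighbours du du)
      where
      off : u ∉ p → Dec (H u) →
        ¬ (∃₂ λ x y → (x ∈ I × Adj G u x × Adj G u x) × (y ∈ I × Adj G u y × Adj G u y) × x ≢ y)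
      -- One of two distinct neighbours in `I` differs from `w`, hence is a successor, and no
      -- successor has a neighbour in `H`.
      off u∉p (yes hu) (_ , _ , (there y∈ , uy , _) , _)   = ¬H-successor hu (successor y∈) uy
      off u∉p (yes hu) (_ , _ , _ , (there y∈ , uy , _) , _) = ¬H-successor hu (successor y∈) uy
      off u∉p _ (_ , _ , (here refl , _) , (here refl , _) , x≢y) = x≢y refl
      -- Outside `H`, `u` is not adjacent to `w`; both neighbours are then successors and allow a
      -- detour through `u`.
      off u∉p (no ¬hu) (_ , _ , (here refl , uw , _) , _) = ¬hu ((w∉p , u∉p , adj-sym G uw) ◅ ε)
      off u∉p (no ¬hu) (_ , _ , _ , (here refl , uw , _) , _) = ¬hu ((w∉p , u∉p , adj-sym G uw) ◅ ε)
      off u∉p (no ¬hu) (_ , _ , (there y∈ , uy , _) , (there y′∈ , uy′ , _) , y≢y′)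
        = let x , c , nx = successor y∈ ; x′ , c′ , nx′ = successor y′∈ in
          Sum.[ (λ c² → no-detour c² nx nx′ u∉p ¬hu uy uy′)
              , (λ c² → no-detour c² nx′ nx u∉p ¬hu uy′ uy) ]′ (order² c c′ y≢y′)

    incomplete : ¬ Complete G
    incomplete complete = let x , y , x∈ , y∈ , x≢y = two-distinct I-unique 2≤∣I∣ in
      I-independent x∈ y∈ (complete x y x≢y)

    S : Subset n
    S = comprehension dominated?

    undominated⇒∈∁S : ∀ {v} → ¬ Dominated v → v ∈ˢ ∁ S
    undominated⇒∈∁S ¬dv = x∉p⇒x∈∁p (¬dv ∘ ∈-comprehension⁻ dominated?)

    length≤components : ∀ {xs} → Unique xs → All (¬_ ∘ Dominated) xs → length xs ≤ c G (∁ S)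
    length≤components xs! undom = independent-length≤c G
      (λ u∈ v∈ → undominated-independent (x∈∁p⇒x∉p u∈ ∘ ∈-comprehension⁺ dominated?)
                                         (x∈∁p⇒x∉p v∈ ∘ ∈-comprehension⁺ dominated?))
      xs! (All.map undominated⇒∈∁S undom)

    -- `w` and the undominated vertices on `p` are isolated once `S` is deleted, toughness makes `S`
    -- larger than the number of components, and all of `S` is on `p`. Counting `w` yields the
    -- `suc`.
    more-dominated : suc (length (filter (¬? ∘ dominated?) p)) < length (filter dominated? p)
    more-dominated = begin-strict
      length (w ∷ filter (¬? ∘ dominated?) p) ≤⟨ length≤components
        (All.tabulate (λ { z∈ refl → w∉p (proj₁ (∈-filter⁻ (¬? ∘ dominated?) {xs = p} z∈)) })
          ∷ Unique.filter⁺ _ (proj₂ path))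
        (undominated (here refl) ∷ All.tabulate λ z∈ → proj₂ (∈-filter⁻ (¬? ∘ dominated?) {xs = p} z∈)) ⟩
      c G (∁ S) <⟨ 1<τ⇒c<∣∣ G 1<τ incomplete S
        -- `S` is admissible because `I` provides two undominated vertices.
        (≤-trans 2≤∣I∣ (length≤components I-unique (All.tabulate undominated))) ⟩
      ∣ S ∣ ≤⟨ ∣∣≤length S (λ x∈ → let dx = ∈-comprehension⁻ dominated? x∈ in
                 ∈-filter⁺ dominated? (dominated⇒∈p dx) dx) ⟩
      length (filter dominated? p) ∎
      where open ≤-Reasoning

    absurd : ⊥
    absurd = let u , v , c , du , dv = consecutive G dominated? (proj₁ path) more-dominated in
      no-consecutive c du dv

mainTheorem1 : (k : ℕ) .{{_ : NonZero k}} {n : ℕ} (G : Graph (Fin n)) →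
    (2 * k) IsConnected G →
    G IsFree (P 2 ∪ k · P 1) →
    [ 1ℚ ] <∞ τ G →
    HamiltonianConnected G
mainTheorem1 k {n} G connected free 1<τ a b a≢b =
  p , path⇒isPath path , λ v → decidable-stable (v ∈ˡ? p) λ v∉p →
    Maximal.Contradiction.absurd G path a≢b longest v∉p connected free 1<τ
  where
  open Walks G

  0<2k : ∣ ∅ {n} ∣ < 2 * k
  0<2k = subst (_< 2 * k) (sym (∣⊥∣≡0 n)) (≤-trans (>-nonZero⁻¹ k) (m≤m+n k _))

  -- Deleting the empty set, of size below `2 * k`, leaves a connected graph.
  some-path : ∃ (Path a b)
  some-path with q , path , _ ← star⇒path (λ (_ , _ , e) → e)
    (proj₂ connected ∅ 0<2k (x∉p⇒x∈∁p ∉⊥) (x∉p⇒x∈∁p ∉⊥)) = q , path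

  short : ∀ {q} → Path a b q → length q ≤ n
  short {q} (_ , q!) = subst (length q ≤_) (length-tabulate id) (unique-⊆⇒length≤ q! λ {x} _ → ∈-allFin x)

  longest-path : ∃ λ p → Path a b p × (∀ {q} → Path a b q → length q ≤ length p)
  longest-path = longest-list (path? a b) n short some-path

  p       = proj₁ longest-path
  path    = proj₁ (proj₂ longest-path)
  longest = λ {q} → proj₂ (proj₂ longest-path) {q}
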